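{- An abstract logic $\langle\mathbf A,\mathbf C\rangle$ (with $\mathbf A$ an algebra of type $\{\land,\lor,\otimes,\oplus,\neg\}$) is a full model of $\mathcal{LB}$ if and only if it is finitary and satisfies, for all $a,b\in A$ and all $X\subseteq A$, the following properties: (E) $\mathbf C(\emptyset)=\emptyset$; (PC) $\mathbf C(a\land b)=\mathbf C(a\otimes b)=\mathbf C(a,b)$; (PDI) $\mathbf C(X,a\lor b)=\mathbf C(X,a\oplus b)=\mathbf C(X,a)\cap\mathbf C(X,b)$; (PDN) $\mathbf C(a)=\mathbf C(\neg\neg a)$; (PDM) $\mathbf C(\neg(a\land b))=\mathbf C(\neg a\lor\neg b)$, $\mathbf C(\neg(a\lor b))=\mathbf C(\neg a\land\neg b)$, $\mathbf C(\neg(a\otimes b))=\mathbf C(\neg a\otimes\neg b)$, $\mathbf C(\neg(a\oplus b))=\mathbf C(\neg a\oplus\neg b)$.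
   Context: $\mathcal{FOUR}$ is the algebra with universe $\{\mathsf f,\bot,\top,\mathsf t\}$ where $\land,\lor$ are meet and join of the lattice order $\leq_t$ with $\mathsf f <_t \bot,\top <_t \mathsf t$ ($\bot,\top$ $\leq_t$-incomparable), $\otimes,\oplus$ are meet and join of the lattice order $\leq_k$ with $\bot <_k \mathsf f,\mathsf t <_k \top$ ($\mathsf f,\mathsf t$ $\leq_k$-incomparable), and $\neg \mathsf f = \mathsf t$, $\neg\mathsf t=\mathsf f$, $\neg\bot=\bot$, $\neg\top=\top$. Let $\mathsf{Tr}=\{\top,\mathsf t\}$. $\mathbf{Fm}$ is the formula algebra over a countable set of variables in the language $\{\land,\lor,\otimes,\oplus,\neg\}$ (no constants), and $\mathcal{LB}$ is the logic given by: $\Gamma\models_{\mathcal{LB}}\varphi$ iff for every homomorphism $h:\mathbf{Fm}\to\mathcal{FOUR}$, $h[\Gamma]\subseteq \mathsf{Tr}$ implies $h(\varphi)\in\mathsf{Tr}$. A set $F\subseteq A$ is an $\mathcal{LB}$-filter of $\mathbf A$ if whenever $\Gamma\models_{\mathcal{LB}}\varphi$ and $h:\mathbf{Fm}\to\mathbf A$ is a homomorphism with $h[\Gamma]\subseteq F$, then $h(\varphi)\in F$; $\mathcal Fi_{\mathcal{LB}}\mathbf A$ is the closure system of all $\mathcal{LB}$-filters of $\mathbf A$. An abstract logic is a pair $\langle\mathbf A,\mathbf C\rangle$ with $\mathbf C$ a closure operator on $A$ (identified with the corresponding closure system); it is finitary if $a\in\mathbf C(X)$ implies $a\in\mathbf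 C(X_0)$ for some finite $X_0\subseteq X$. Notation: $\mathbf C(X,a)=\mathbf C(X\cup\{a\})$. A bilogical morphism from $\langle\mathbf A,\mathbf C\rangle$ to $\langle\mathbf A',\mathbf C'\rangle$ is a surjective homomorphism $h:\mathbf A\to\mathbf A'$ such that for all $X\cup\{a\}\subseteq A$: $a\in\mathbf C(X)$ iff $h(a)\in\mathbf C'(h[X])$. $\langle\mathbf A,\mathbf C\rangle$ is a full model of $\mathcal{LB}$ if there is a bilogical morphism from it to some abstract logic whose closure system is of the form $\mathcal Fi_{\mathcal{LB}}\mathbf A'$ on an algebra $\mathbf A'$. -}

module Defs where

open import Level using (Level; 0ℓ; _⊔_) renaming (suc to lsuc)
open import Algebra.Core using (Op₁; Op₂)
open import Algebra.Definitions using (Congruent₁; Congruent₂)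
open import Data.Empty.Polymorphic using (⊥)
open import Data.List.Base using (List)
open import Data.List.Relation.Unary.All using (All)
import Data.List.Membership.Setoid as SetoidMembership
open import Data.Nat.Base using (ℕ)
open import Data.Product.Base using (_×_; _,_; ∃-syntax; Σ-syntax)
open import Function.Bundles using (_⇔_)
open import Function.Definitions using (Surjective)
open import Relation.Binary.Bundles using (Setoid)
open import Relation.Binary.Core using (Rel)
open import Relation.Binary.Definitions using (Decidable; _Respects_)
open import Relation.Binary.Lattice.Structures using (IsLattice)
open import Relation.Binary.PropositionalEquality.Core using (_≡_; refl; cong; cong₂)
open import Relation.Binary.PropositionalEquality.Properties using (isEquivalence)
open import Relation.Binary.Structures using (IsEquivalence)
open import Relation.Nullary.Decidable.Core
  using (Dec; yes; no; map′; from-yes; _×-dec_; _→-dec_)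
open import Relation.Unary using (Pred; _∈_; _⊆_; _≐_; _∪_; _∩_)

-- Carriers are setoids, so that quotient algebras exist.
record Algebra (c e : Level) : Set (lsuc (c ⊔ e)) where
  infixr 7 _∧_ _⊗_
  infixr 6 _∨_ _⊕_
  infix  8 ¬_
  infix  4 _≈_
  field
    Carrier       : Set c
    _≈_           : Rel Carrier e
    ≈-equivalence : IsEquivalence _≈_
    _∧_ _∨_ _⊗_ _⊕_ : Op₂ Carrier
    ¬_            : Op₁ Carrier
    ∧-cong        : Congruent₂ _≈_ _∧_
    ∨-cong        : Congruent₂ _≈_ _∨_
    ⊗-cong        : Congruent₂ _≈_ _⊗_
    ⊕-cong        : Congruent₂ _≈_ _⊕_
    ¬-cong        : Congruent₁ _≈_ ¬_

  carrierSetoid : Setoid c e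
  carrierSetoid = record { isEquivalence = ≈-equivalence }

record IsHomomorphism {c₁ e₁ c₂ e₂ : Level} (𝐀 : Algebra c₁ e₁) (𝐁 : Algebra c₂ e₂)
    (h : Algebra.Carrier 𝐀 → Algebra.Carrier 𝐁) : Set (c₁ ⊔ e₁ ⊔ e₂) where
  private
    module A = Algebra 𝐀
    module B = Algebra 𝐁
  field
    ≈-cong : ∀ {a b} → a A.≈ b → h a B.≈ h b
    ∧-homo : ∀ a b → h (a A.∧ b) B.≈ h a B.∧ h b
    ∨-homo : ∀ a b → h (a A.∨ b) B.≈ h a B.∨ h b
    ⊗-homo : ∀ a b → h (a A.⊗ b) B.≈ h a B.⊗ h b
    ⊕-homo : ∀ a b → h (a A.⊕ b) B.≈ h a B.⊕ h b
    ¬-homo : ∀ a   → h (A.¬ a)   B.≈ B.¬ h a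

data Formula : Set where
  var : ℕ → Formula
  _∧ᶠ_ _∨ᶠ_ _⊗ᶠ_ _⊕ᶠ_ : Formula → Formula → Formula
  ¬ᶠ_ : Formula → Formula

𝐅𝐦 : Algebra 0ℓ 0ℓ
𝐅𝐦 = record
  { Carrier = Formula ; _≈_ = _≡_ ; ≈-equivalence = isEquivalence
  ; _∧_ = _∧ᶠ_ ; _∨_ = _∨ᶠ_ ; _⊗_ = _⊗ᶠ_ ; _⊕_ = _⊕ᶠ_ ; ¬_ = ¬ᶠ_
  ; ∧-cong = cong₂ _∧ᶠ_ ; ∨-cong = cong₂ _∨ᶠ_
  ; ⊗-cong = cong₂ _⊗ᶠ_ ; ⊕-cong = cong₂ _⊕ᶠ_ ; ¬-cong = cong ¬ᶠ_
  }

data Four : Set where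
  𝐟 ⊥₄ ⊤₄ 𝐭 : Four

data _≤ₜ_ : Rel Four 0ℓ where
  ≤ₜ-refl : ∀ {x} → x ≤ₜ x
  𝐟-min   : ∀ {x} → 𝐟 ≤ₜ x
  𝐭-max   : ∀ {x} → x ≤ₜ 𝐭

data _≤ₖ_ : Rel Four 0ℓ where
  ≤ₖ-refl : ∀ {x} → x ≤ₖ x
  ⊥-min   : ∀ {x} → ⊥₄ ≤ₖ x
  ⊤-max   : ∀ {x} → x ≤ₖ ⊤₄

_∧₄_ _∨₄_ _⊗₄_ _⊕₄_ : Op₂ Four

𝐟  ∧₄ y  = 𝐟
𝐭  ∧₄ y  = y
⊥₄ ∧₄ 𝐟  = 𝐟
⊥₄ ∧₄ ⊥₄ = ⊥₄
⊥₄ ∧₄ ⊤₄ = 𝐟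
⊥₄ ∧₄ 𝐭  = ⊥₄
⊤₄ ∧₄ 𝐟  = 𝐟
⊤₄ ∧₄ ⊥₄ = 𝐟
⊤₄ ∧₄ ⊤₄ = ⊤₄
⊤₄ ∧₄ 𝐭  = ⊤₄

𝐟  ∨₄ y  = y
𝐭  ∨₄ y  = 𝐭
⊥₄ ∨₄ 𝐟  = ⊥₄
⊥₄ ∨₄ ⊥₄ = ⊥₄
⊥₄ ∨₄ ⊤₄ = 𝐭
⊥₄ ∨₄ 𝐭  = 𝐭
⊤₄ ∨₄ 𝐟  = ⊤₄
⊤₄ ∨₄ ⊥₄ = 𝐭
⊤₄ ∨₄ ⊤₄ = ⊤₄
⊤₄ ∨₄ 𝐭  = 𝐭

⊥₄ ⊗₄ y  = ⊥₄
⊤₄ ⊗₄ y  = y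
𝐟  ⊗₄ 𝐟  = 𝐟
𝐟  ⊗₄ ⊥₄ = ⊥₄
𝐟  ⊗₄ ⊤₄ = 𝐟
𝐟  ⊗₄ 𝐭  = ⊥₄
𝐭  ⊗₄ 𝐟  = ⊥₄
𝐭  ⊗₄ ⊥₄ = ⊥₄
𝐭  ⊗₄ ⊤₄ = 𝐭
𝐭  ⊗₄ 𝐭  = 𝐭

⊥₄ ⊕₄ y  = y
⊤₄ ⊕₄ y  = ⊤₄
𝐟  ⊕₄ 𝐟  = 𝐟
𝐟  ⊕₄ ⊥₄ = 𝐟
𝐟  ⊕₄ ⊤₄ = ⊤₄
𝐟  ⊕₄ 𝐭  = ⊤₄
𝐭  ⊕₄ 𝐟  = ⊤₄
𝐭  ⊕₄ ⊥₄ = 𝐭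
𝐭  ⊕₄ ⊤₄ = ⊤₄
𝐭  ⊕₄ 𝐭  = 𝐭

¬₄_ : Op₁ Four
¬₄ 𝐟  = 𝐭
¬₄ ⊥₄ = ⊥₄
¬₄ ⊤₄ = ⊤₄
¬₄ 𝐭  = 𝐟

_≟₄_ : Decidable {A = Four} _≡_
𝐟  ≟₄ 𝐟  = yes refl
𝐟  ≟₄ ⊥₄ = no λ ()
𝐟  ≟₄ ⊤₄ = no λ ()
𝐟  ≟₄ 𝐭  = no λ ()
⊥₄ ≟₄ 𝐟  = no λ ()
⊥₄ ≟₄ ⊥₄ = yes refl
⊥₄ ≟₄ ⊤₄ = no λ ()
⊥₄ ≟₄ 𝐭  = no λ ()
⊤₄ ≟₄ 𝐟  = no λ ()
⊤₄ ≟₄ ⊥₄ = no λ ()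
⊤₄ ≟₄ ⊤₄ = yes refl
⊤₄ ≟₄ 𝐭  = no λ ()
𝐭  ≟₄ 𝐟  = no λ ()
𝐭  ≟₄ ⊥₄ = no λ ()
𝐭  ≟₄ ⊤₄ = no λ ()
𝐭  ≟₄ 𝐭  = yes refl

_≤ₜ?_ : Decidable _≤ₜ_
𝐟  ≤ₜ? y  = yes 𝐟-min
⊥₄ ≤ₜ? 𝐟  = no λ ()
⊥₄ ≤ₜ? ⊥₄ = yes ≤ₜ-refl
⊥₄ ≤ₜ? ⊤₄ = no λ ()
⊥₄ ≤ₜ? 𝐭  = yes 𝐭-max
⊤₄ ≤ₜ? 𝐟  = no λ ()
⊤₄ ≤ₜ? ⊥₄ = no λ ()
⊤₄ ≤ₜ? ⊤₄ = yes ≤ₜ-refl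
⊤₄ ≤ₜ? 𝐭  = yes 𝐭-max
𝐭  ≤ₜ? 𝐟  = no λ ()
𝐭  ≤ₜ? ⊥₄ = no λ ()
𝐭  ≤ₜ? ⊤₄ = no λ ()
𝐭  ≤ₜ? 𝐭  = yes ≤ₜ-refl

_≤ₖ?_ : Decidable _≤ₖ_
⊥₄ ≤ₖ? y  = yes ⊥-min
𝐟  ≤ₖ? ⊥₄ = no λ ()
𝐟  ≤ₖ? 𝐟  = yes ≤ₖ-refl
𝐟  ≤ₖ? 𝐭  = no λ ()
𝐟  ≤ₖ? ⊤₄ = yes ⊤-max
𝐭  ≤ₖ? ⊥₄ = no λ ()
𝐭  ≤ₖ? 𝐟  = no λ ()
𝐭  ≤ₖ? 𝐭  = yes ≤ₖ-refl
𝐭  ≤ₖ? ⊤₄ = yes ⊤-max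
⊤₄ ≤ₖ? ⊥₄ = no λ ()
⊤₄ ≤ₖ? 𝐟  = no λ ()
⊤₄ ≤ₖ? 𝐭  = no λ ()
⊤₄ ≤ₖ? ⊤₄ = yes ≤ₖ-refl

∀₄? : {p : Level} {P : Pred Four p} → (∀ x → Dec (P x)) → Dec (∀ x → P x)
∀₄? P? = map′
  (λ { (p , q , r , s) → λ { 𝐟 → p ; ⊥₄ → q ; ⊤₄ → r ; 𝐭 → s } })
  (λ p → p 𝐟 , p ⊥₄ , p ⊤₄ , p 𝐭)
  (P? 𝐟 ×-dec P? ⊥₄ ×-dec P? ⊤₄ ×-dec P? 𝐭)

≤ₜ-isLattice : IsLattice _≡_ _≤ₜ_ _∨₄_ _∧₄_
≤ₜ-isLattice = record
  { isPartialOrder = record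
    { isPreorder = record
      { isEquivalence = isEquivalence
      ; reflexive     = λ { refl → ≤ₜ-refl }
      ; trans         = λ {x} {y} {z} → from-yes
          (∀₄? λ x → ∀₄? λ y → ∀₄? λ z →
            (x ≤ₜ? y) →-dec (y ≤ₜ? z) →-dec (x ≤ₜ? z)) x y z
      }
    ; antisym = λ {x} {y} → from-yes
        (∀₄? λ x → ∀₄? λ y → (x ≤ₜ? y) →-dec (y ≤ₜ? x) →-dec (x ≟₄ y)) x y
    }
  ; supremum = from-yes
      (∀₄? λ x → ∀₄? λ y →
        (x ≤ₜ? (x ∨₄ y)) ×-dec (y ≤ₜ? (x ∨₄ y)) ×-dec
        ∀₄? λ z → (x ≤ₜ? z) →-dec (y ≤ₜ? z) →-dec ((x ∨₄ y) ≤ₜ? z))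
  ; infimum = from-yes
      (∀₄? λ x → ∀₄? λ y →
        ((x ∧₄ y) ≤ₜ? x) ×-dec ((x ∧₄ y) ≤ₜ? y) ×-dec
        ∀₄? λ z → (z ≤ₜ? x) →-dec (z ≤ₜ? y) →-dec (z ≤ₜ? (x ∧₄ y)))
  }

≤ₖ-isLattice : IsLattice _≡_ _≤ₖ_ _⊕₄_ _⊗₄_
≤ₖ-isLattice = record
  { isPartialOrder = record
    { isPreorder = record
      { isEquivalence = isEquivalence
      ; reflexive     = λ { refl → ≤ₖ-refl }
      ; trans         = λ {x} {y} {z} → from-yes
          (∀₄? λ x → ∀₄? λ y → ∀₄? λ z →
            (x ≤ₖ? y) →-dec (y ≤ₖ? z) →-dec (x ≤ₖ? z)) x y z
      }
    ; antisym = λ {x} {y} → from-yes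
        (∀₄? λ x → ∀₄? λ y → (x ≤ₖ? y) →-dec (y ≤ₖ? x) →-dec (x ≟₄ y)) x y
    }
  ; supremum = from-yes
      (∀₄? λ x → ∀₄? λ y →
        (x ≤ₖ? (x ⊕₄ y)) ×-dec (y ≤ₖ? (x ⊕₄ y)) ×-dec
        ∀₄? λ z → (x ≤ₖ? z) →-dec (y ≤ₖ? z) →-dec ((x ⊕₄ y) ≤ₖ? z))
  ; infimum = from-yes
      (∀₄? λ x → ∀₄? λ y →
        ((x ⊗₄ y) ≤ₖ? x) ×-dec ((x ⊗₄ y) ≤ₖ? y) ×-dec
        ∀₄? λ z → (z ≤ₖ? x) →-dec (z ≤ₖ? y) →-dec (z ≤ₖ? (x ⊗₄ y)))
  }

𝓕𝓞𝓤𝓡 : Algebra 0ℓ 0ℓ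
𝓕𝓞𝓤𝓡 = record
  { Carrier = Four ; _≈_ = _≡_ ; ≈-equivalence = isEquivalence
  ; _∧_ = _∧₄_ ; _∨_ = _∨₄_ ; _⊗_ = _⊗₄_ ; _⊕_ = _⊕₄_ ; ¬_ = ¬₄_
  ; ∧-cong = cong₂ _∧₄_ ; ∨-cong = cong₂ _∨₄_
  ; ⊗-cong = cong₂ _⊗₄_ ; ⊕-cong = cong₂ _⊕₄_ ; ¬-cong = cong ¬₄_
  }

data Tr : Pred Four 0ℓ where
  ⊤∈Tr : ⊤₄ ∈ Tr
  𝐭∈Tr : 𝐭 ∈ Tr

infix 4 _⊨_

-- Γ may be infinite and undecidable; that Γ ⊨ φ implies Γ₀ ⊨ φ for some finite
-- Γ₀ ⊆ Γ is a classical fact, whence the use of excluded middle.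

_⊨_ : {ℓ : Level} → Pred Formula ℓ → Formula → Set ℓ
Γ ⊨ φ = ∀ h → IsHomomorphism 𝐅𝐦 𝓕𝓞𝓤𝓡 h → (∀ γ → γ ∈ Γ → h γ ∈ Tr) → h φ ∈ Tr

-- A subset of a setoid is a predicate invariant under its equality; this has to
-- be required, since the second condition alone does not imply it.
record IsFilter {ℓ : Level} (𝐀 : Algebra ℓ ℓ) (F : Pred (Algebra.Carrier 𝐀) ℓ)
    : Set (lsuc ℓ) where
  open Algebra 𝐀
  field
    respects : F Respects _≈_
    closed   : ∀ (Γ : Pred Formula ℓ) φ → Γ ⊨ φ →
               ∀ h → IsHomomorphism 𝐅𝐦 𝐀 h → (∀ γ → γ ∈ Γ → h γ ∈ F) → h φ ∈ F

-- C is applied to arbitrary predicates, but only its values on predicates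
-- invariant under _≈_ carry information: by the laws below, C X equals C of the
-- closure of X under _≈_.
record AbstractLogic (ℓ : Level) : Set (lsuc ℓ) where
  field
    algebra : Algebra ℓ ℓ
  open Algebra algebra public
  field
    C          : Pred Carrier ℓ → Pred Carrier ℓ
    respects   : ∀ X → C X Respects _≈_
    extensive  : ∀ X → X ⊆ C X
    monotone   : ∀ X Y → X ⊆ Y → C X ⊆ C Y
    idempotent : ∀ X → C (C X) ⊆ C X

  Closed : Pred Carrier ℓ → Set ℓ
  Closed X = C X ≐ X

  ∅ : Pred Carrier ℓ
  ∅ _ = ⊥

  ｛_｝ : Carrier → Pred Carrier ℓ
  ｛ a ｝ x = x ≈ a

  ⟦_⟧ : List Carrier → Pred Carrier ℓ
  ⟦ xs ⟧ x = x ∈ₗ xs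
    where open SetoidMembership carrierSetoid renaming (_∈_ to _∈ₗ_)

  C[_] : Carrier → Pred Carrier ℓ
  C[ a ] = C ｛ a ｝

  C[_⨾_] : Pred Carrier ℓ → Carrier → Pred Carrier ℓ
  C[ X ⨾ a ] = C (X ∪ ｛ a ｝)

  Finitary : Set (lsuc ℓ)
  Finitary = ∀ X a → a ∈ C X → ∃[ xs ] All (_∈ X) xs × a ∈ C ⟦ xs ⟧

  E : Set ℓ
  E = C ∅ ≐ ∅

  PC : Set ℓ
  PC = ∀ a b → C[ a ∧ b ] ≐ C[ a ⊗ b ] × C[ a ⊗ b ] ≐ C (｛ a ｝ ∪ ｛ b ｝)

  PDI : Set (lsuc ℓ)
  PDI = ∀ X a b → C[ X ⨾ a ∨ b ] ≐ C[ X ⨾ a ⊕ b ]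
                × C[ X ⨾ a ⊕ b ] ≐ C[ X ⨾ a ] ∩ C[ X ⨾ b ]

  PDN : Set ℓ
  PDN = ∀ a → C[ a ] ≐ C[ ¬ ¬ a ]

  PDM : Set ℓ
  PDM = ∀ a b → C[ ¬ (a ∧ b) ] ≐ C[ ¬ a ∨ ¬ b ]
              × C[ ¬ (a ∨ b) ] ≐ C[ ¬ a ∧ ¬ b ]
              × C[ ¬ (a ⊗ b) ] ≐ C[ ¬ a ⊗ ¬ b ]
              × C[ ¬ (a ⊕ b) ] ≐ C[ ¬ a ⊕ ¬ b ]

record IsBilogicalMorphism {ℓ : Level} (𝕃 𝕃′ : AbstractLogic ℓ)
    (h : AbstractLogic.Carrier 𝕃 → AbstractLogic.Carrier 𝕃′) : Set (lsuc ℓ) where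
  private
    module L  = AbstractLogic 𝕃
    module L′ = AbstractLogic 𝕃′

  image : Pred L.Carrier ℓ → Pred L′.Carrier ℓ
  image X y = ∃[ x ] x ∈ X × h x L′.≈ y

  field
    isHomomorphism : IsHomomorphism L.algebra L′.algebra h
    surjective     : Surjective L._≈_ L′._≈_ h
    bilogical      : ∀ X a → a ∈ L.C X ⇔ h a ∈ L′.C (image X)

ClosedSetsAreExactlyFilters : {ℓ : Level} → AbstractLogic ℓ → Set (lsuc ℓ)
ClosedSetsAreExactlyFilters 𝕃 = ∀ F → Closed F ⇔ IsFilter algebra F
  where open AbstractLogic 𝕃

IsFullModel : {ℓ : Level} → AbstractLogic ℓ → Set (lsuc ℓ)
IsFullModel {ℓ} 𝕃 =
  Σ[ 𝕃′ ∈ AbstractLogic ℓ ] ClosedSetsAreExactlyFilters 𝕃′ × ∃[ h ] IsBilogicalMorphism 𝕃 𝕃′ h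

{-# OPTIONS --safe #-}
module Submission where

-- For the logic of all filters of an algebra, (PDI) holds because
-- { c | c ∨ b ∈ F } is a filter whenever F is one, finitarity comes from the
-- compactness of ⊨, and the remaining properties are single consequences of ⊨;
-- everything is pulled back along a bilogical morphism.  Conversely, identify a
-- and b when C[ a ] = C[ b ] and C[ ¬ a ] = C[ ¬ b ].  By the stated properties
-- this is a congruence, and closed sets of the quotient are filters: to derive φ
-- from finitely many premises, (PDI) reduces to the case in which the premises
-- are true in 𝓕𝓞𝓤𝓡 under the valuation read off from which h x and ¬ h x are in
-- the closed set.  A filter F is closed: by finitarity, (E) and (PC) it is enough
-- that a ∈ C[ b ] and b ∈ F give a ∈ F, and then a is identified with
-- a ∨ (a ⊕ b), a consequence of b.

open import Defs
open import Axiom.ExcludedMiddle using (ExcludedMiddle)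
open import Data.Product.Base using (_×_)
open import Function.Bundles using (_⇔_)
open import Level using (Level)

open import Data.Empty using (⊥-elim)
open import Data.List.Base using (List; []; _∷_; [_]; _++_)
open import Data.List.Membership.Propositional using () renaming (_∈_ to _∈ₗ_)
open import Data.List.Membership.Setoid.Properties using (∈-++⁺ˡ; ∈-++⁺ʳ)
open import Data.List.Relation.Unary.All as All using (All; []; _∷_)
open import Data.List.Relation.Unary.All.Properties using (++⁺; ++⁻)
open import Data.List.Relation.Unary.Any using (here; there)
open import Data.Nat.Base using (ℕ; zero; suc; _<_; _⊔_)
open import Data.Nat.Properties using (m<1+n⇒m<n∨m≡n; ≤-refl; m≤n⇒m≤n⊔o; m≤n⇒m≤o⊔n)
open import Data.Product.Base using (_,_; ∃; ∃-syntax; proj₁; proj₂; uncurry; <_,_>)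
open import Data.Sum.Base using (_⊎_; inj₁; inj₂; [_,_]′)
open import Function.Base using (_∘_; id; _$_)
open import Function.Bundles using (mk⇔; Equivalence)
open import Level using (0ℓ; Lift; lift; lower) renaming (suc to lsuc)
open import Relation.Binary.PropositionalEquality using (_≡_; refl; sym; cong; cong₂; subst)
open import Relation.Binary.Structures using (IsEquivalence)
open import Relation.Nullary.Decidable
  using (Dec; yes; no; map′; from-yes; _×-dec_; _⊎-dec_; _→-dec_; decidable-stable)
open import Relation.Nullary.Negation using () renaming (¬_ to Not)
open import Relation.Unary using (Pred; _∈_; _⊆_; _≐_; _∪_; _∩_; U)
open import Relation.Unary.Properties using (≐-refl; ≐-sym; ≐-trans)

open Equivalence using (to; from)

-- Truth of compound formulas and of their negations in `𝓕𝓞𝓤𝓡`.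

_⇔?_ : ∀ {p q} {P : Set p} {Q : Set q} → Dec P → Dec Q → Dec (P ⇔ Q)
p? ⇔? q? = map′ (uncurry mk⇔) < to , from > ((p? →-dec q?) ×-dec (q? →-dec p?))

Tr? : ∀ x → Dec (x ∈ Tr)
Tr? 𝐟  = no λ ()
Tr? ⊥₄ = no λ ()
Tr? ⊤₄ = yes ⊤∈Tr
Tr? 𝐭  = yes 𝐭∈Tr

Tr-∧ : ∀ x y → x ∧₄ y ∈ Tr ⇔ (x ∈ Tr × y ∈ Tr)
Tr-∧ = from-yes (∀₄? λ x → ∀₄? λ y → Tr? (x ∧₄ y) ⇔? (Tr? x ×-dec Tr? y))

Tr-⊗ : ∀ x y → x ⊗₄ y ∈ Tr ⇔ (x ∈ Tr × y ∈ Tr)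
Tr-⊗ = from-yes (∀₄? λ x → ∀₄? λ y → Tr? (x ⊗₄ y) ⇔? (Tr? x ×-dec Tr? y))

Tr-∨ : ∀ x y → x ∨₄ y ∈ Tr ⇔ (x ∈ Tr ⊎ y ∈ Tr)
Tr-∨ = from-yes (∀₄? λ x → ∀₄? λ y → Tr? (x ∨₄ y) ⇔? (Tr? x ⊎-dec Tr? y))

Tr-⊕ : ∀ x y → x ⊕₄ y ∈ Tr ⇔ (x ∈ Tr ⊎ y ∈ Tr)
Tr-⊕ = from-yes (∀₄? λ x → ∀₄? λ y → Tr? (x ⊕₄ y) ⇔? (Tr? x ⊎-dec Tr? y))

Tr-¬∧ : ∀ x y → ¬₄ (x ∧₄ y) ∈ Tr ⇔ (¬₄ x ∈ Tr ⊎ ¬₄ y ∈ Tr)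
Tr-¬∧ = from-yes (∀₄? λ x → ∀₄? λ y → Tr? (¬₄ (x ∧₄ y)) ⇔? (Tr? (¬₄ x) ⊎-dec Tr? (¬₄ y)))

Tr-¬∨ : ∀ x y → ¬₄ (x ∨₄ y) ∈ Tr ⇔ (¬₄ x ∈ Tr × ¬₄ y ∈ Tr)
Tr-¬∨ = from-yes (∀₄? λ x → ∀₄? λ y → Tr? (¬₄ (x ∨₄ y)) ⇔? (Tr? (¬₄ x) ×-dec Tr? (¬₄ y)))

Tr-¬⊗ : ∀ x y → ¬₄ (x ⊗₄ y) ∈ Tr ⇔ (¬₄ x ∈ Tr × ¬₄ y ∈ Tr)
Tr-¬⊗ = from-yes (∀₄? λ x → ∀₄? λ y → Tr? (¬₄ (x ⊗₄ y)) ⇔? (Tr? (¬₄ x) ×-dec Tr? (¬₄ y)))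

Tr-¬⊕ : ∀ x y → ¬₄ (x ⊕₄ y) ∈ Tr ⇔ (¬₄ x ∈ Tr ⊎ ¬₄ y ∈ Tr)
Tr-¬⊕ = from-yes (∀₄? λ x → ∀₄? λ y → Tr? (¬₄ (x ⊕₄ y)) ⇔? (Tr? (¬₄ x) ⊎-dec Tr? (¬₄ y)))

Tr-¬¬ : ∀ x → ¬₄ ¬₄ x ∈ Tr ⇔ x ∈ Tr
Tr-¬¬ = from-yes (∀₄? λ x → Tr? (¬₄ ¬₄ x) ⇔? Tr? x)

-- Evaluation of formulas and uniqueness of homomorphisms.

module _ {c e} (𝐀 : Algebra c e) where
  open Algebra 𝐀

  eval : (ℕ → Carrier) → Formula → Carrier
  eval v (var n)  = v n
  eval v (φ ∧ᶠ ψ) = eval v φ ∧ eval v ψ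
  eval v (φ ∨ᶠ ψ) = eval v φ ∨ eval v ψ
  eval v (φ ⊗ᶠ ψ) = eval v φ ⊗ eval v ψ
  eval v (φ ⊕ᶠ ψ) = eval v φ ⊕ eval v ψ
  eval v (¬ᶠ φ)   = ¬ eval v φ

  private module ≈ = IsEquivalence ≈-equivalence

  eval-isHomomorphism : ∀ v → IsHomomorphism 𝐅𝐦 𝐀 (eval v)
  eval-isHomomorphism v = record
    { ≈-cong = λ { refl → ≈.refl }
    ; ∧-homo = λ _ _ → ≈.refl ; ∨-homo = λ _ _ → ≈.refl
    ; ⊗-homo = λ _ _ → ≈.refl ; ⊕-homo = λ _ _ → ≈.refl
    ; ¬-homo = λ _ → ≈.refl
    }

  homomorphism-unique : ∀ {g h} → IsHomomorphism 𝐅𝐦 𝐀 g → IsHomomorphism 𝐅𝐦 𝐀 h →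
    (∀ n → g (var n) ≈ h (var n)) → ∀ φ → g φ ≈ h φ
  homomorphism-unique {g} {h} g-hom h-hom eq = go
    where
    module G = IsHomomorphism g-hom
    module H = IsHomomorphism h-hom
    via : ∀ {a b c d} → a ≈ b → d ≈ c → b ≈ c → a ≈ d
    via p q r = ≈.trans p (≈.trans r (≈.sym q))
    go : ∀ φ → g φ ≈ h φ
    go (var n)  = eq n
    go (φ ∧ᶠ ψ) = via (G.∧-homo φ ψ) (H.∧-homo φ ψ) (∧-cong (go φ) (go ψ))
    go (φ ∨ᶠ ψ) = via (G.∨-homo φ ψ) (H.∨-homo φ ψ) (∨-cong (go φ) (go ψ))
    go (φ ⊗ᶠ ψ) = via (G.⊗-homo φ ψ) (H.⊗-homo φ ψ) (⊗-cong (go φ) (go ψ))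
    go (φ ⊕ᶠ ψ) = via (G.⊕-homo φ ψ) (H.⊕-homo φ ψ) (⊕-cong (go φ) (go ψ))
    go (¬ᶠ φ)   = via (G.¬-homo φ) (H.¬-homo φ) (¬-cong (go φ))

shift : Formula → Formula
shift = eval 𝐅𝐦 (var ∘ suc)

shift-isHomomorphism : ∀ {c e} {𝐀 : Algebra c e} {h} →
  IsHomomorphism 𝐅𝐦 𝐀 h → IsHomomorphism 𝐅𝐦 𝐀 (h ∘ shift)
shift-isHomomorphism {𝐀 = 𝐀} h-hom = record
  { ≈-cong = λ { refl → IsEquivalence.refl (Algebra.≈-equivalence 𝐀) }
  ; ∧-homo = λ _ _ → ∧-homo _ _ ; ∨-homo = λ _ _ → ∨-homo _ _
  ; ⊗-homo = λ _ _ → ⊗-homo _ _ ; ⊕-homo = λ _ _ → ⊕-homo _ _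
  ; ¬-homo = λ _ → ¬-homo _
  }
  where open IsHomomorphism h-hom

-- Compactness of the consequence relation.

val : (ℕ → Four) → Formula → Four
val = eval 𝓕𝓞𝓤𝓡

-- Strictly above every variable index, to match `approx n`, which fixes exactly the variables below
-- `n`.
bound : Formula → ℕ
bound (var n)  = suc n
bound (φ ∧ᶠ ψ) = bound φ ⊔ bound ψ
bound (φ ∨ᶠ ψ) = bound φ ⊔ bound ψ
bound (φ ⊗ᶠ ψ) = bound φ ⊔ bound ψ
bound (φ ⊕ᶠ ψ) = bound φ ⊔ bound ψ
bound (¬ᶠ φ)   = bound φ

val-cong : ∀ {v w} φ → (∀ i → i < bound φ → v i ≡ w i) → val v φ ≡ val w φ
val-cong {v} {w} = go
  where
  go : ∀ φ → (∀ i → i < bound φ → v i ≡ w i) → val v φ ≡ val w φ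
  both : ∀ (_∙_ : Four → Four → Four) φ ψ → (∀ i → i < bound φ ⊔ bound ψ → v i ≡ w i) →
    val v φ ∙ val v ψ ≡ val w φ ∙ val w ψ
  both _∙_ φ ψ eq = cong₂ _∙_
    (go φ λ i i< → eq i (m≤n⇒m≤n⊔o _ i<)) (go ψ λ i i< → eq i (m≤n⇒m≤o⊔n _ i<))
  go (var n)  eq = eq n ≤-refl
  go (φ ∧ᶠ ψ) eq = both _∧₄_ φ ψ eq
  go (φ ∨ᶠ ψ) eq = both _∨₄_ φ ψ eq
  go (φ ⊗ᶠ ψ) eq = both _⊗₄_ φ ψ eq
  go (φ ⊕ᶠ ψ) eq = both _⊕₄_ φ ψ eq
  go (¬ᶠ φ)   eq = cong ¬₄_ (go φ eq)

infix 4 _⊩_ _⊨ₗ_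

_⊩_ : (ℕ → Four) → List Formula → Set
v ⊩ γs = All (λ γ → val v γ ∈ Tr) γs

_⊨ₗ_ : List Formula → Formula → Set
γs ⊨ₗ φ = ∀ v → v ⊩ γs → val v φ ∈ Tr

module _ {ℓ} (em : ExcludedMiddle ℓ) (Γ : Pred Formula ℓ) (φ : Formula) where

  -- A countermodel is built by fixing the values of the variables one by one,
  -- such that no finite part of Γ entails φ over the remaining valuations K.
  Refutes : Pred (ℕ → Four) 0ℓ → List Formula → Set ℓ
  Refutes K γs = All (_∈ Γ) γs × Not (∃[ v ] v ∈ K × v ⊩ γs × Not (val v φ ∈ Tr))

  Open : Pred (ℕ → Four) 0ℓ → Set ℓ
  Open K = Not (∃ (Refutes K))

  -- Otherwise each of the four values would have a finite refuting list, and the concatenation of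
  -- these lists would refute `K` itself, since every valuation takes one of the values at `n`.
  extend : ∀ n K → Open K → ∃[ x ] Open (λ v → v ∈ K × v n ≡ x)
  extend n K open-K with em {R 𝐟} | em {R ⊥₄} | em {R ⊤₄} | em {R 𝐭}
    where
    R : Four → Set ℓ
    R x = ∃ (Refutes (λ v → v ∈ K × v n ≡ x))
  ... | no p  | _     | _     | _     = 𝐟 , p
  ... | yes _ | no p  | _     | _     = ⊥₄ , p
  ... | yes _ | yes _ | no p  | _     = ⊤₄ , p
  ... | yes _ | yes _ | yes _ | no p  = 𝐭 , p
  ... | yes (as , as⊆ , a) | yes (bs , bs⊆ , b) | yes (cs , cs⊆ , c) | yes (ds , ds⊆ , d) =
    ⊥-elim (open-K (as ++ bs ++ cs ++ ds , ++⁺ as⊆ (++⁺ bs⊆ (++⁺ cs⊆ ds⊆)) , impossible))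
    where
    impossible : Not (∃[ v ] v ∈ K × v ⊩ as ++ bs ++ cs ++ ds × Not (val v φ ∈ Tr))
    impossible (v , v∈K , v⊩ , v⊮φ) with ++⁻ as v⊩
    ... | v⊩as , v⊩′ with ++⁻ bs v⊩′
    ... | v⊩bs , v⊩″ with ++⁻ cs v⊩″
    ... | v⊩cs , v⊩ds with v n in eq
    ... | 𝐟  = a (v , (v∈K , eq) , v⊩as , v⊮φ)
    ... | ⊥₄ = b (v , (v∈K , eq) , v⊩bs , v⊮φ)
    ... | ⊤₄ = c (v , (v∈K , eq) , v⊩cs , v⊮φ)
    ... | 𝐭  = d (v , (v∈K , eq) , v⊩ds , v⊮φ)

  module _ (open-U : Open U) where

    approx : ℕ → ∃ Open
    approx zero    = U , open-U
    approx (suc n) =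
      let K , open-K = approx n ; x , open-Kx = extend n K open-K
      in  (λ v → v ∈ K × v n ≡ x) , open-Kx

    limit : ℕ → Four
    limit n = proj₁ (extend n (proj₁ (approx n)) (proj₂ (approx n)))

    approx⇒limit : ∀ n {v} → v ∈ proj₁ (approx n) → ∀ i → i < n → v i ≡ limit i
    approx⇒limit (suc n) (v∈K , vn≡) i i<1+n with m<1+n⇒m<n∨m≡n i<1+n
    ... | inj₁ i<n  = approx⇒limit n v∈K i i<n
    ... | inj₂ refl = vn≡

    limit-val : ∀ γ {v} → v ∈ proj₁ (approx (bound γ)) → val v γ ≡ val limit γ
    limit-val γ v∈K = val-cong γ (approx⇒limit (bound γ) v∈K)

    -- Otherwise `[ γ ]` would refute the stage `bound γ`, whose valuations all agree with `limit`
    -- on `γ`. For `limit-⊮` the empty list serves in the same way.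
    limit-⊩ : ∀ γ → γ ∈ Γ → val limit γ ∈ Tr
    limit-⊩ γ γ∈Γ = decidable-stable (Tr? _) λ limit⊮γ →
      proj₂ (approx (bound γ)) ([ γ ] , γ∈Γ ∷ [] , λ where
        (v , v∈K , v⊩γ ∷ [] , _) → limit⊮γ (subst Tr (limit-val γ v∈K) v⊩γ))

    limit-⊮ : Not (val limit φ ∈ Tr)
    limit-⊮ limit⊩φ = proj₂ (approx (bound φ)) ([] , [] , λ where
      (v , v∈K , _ , v⊮φ) → v⊮φ (subst Tr (sym (limit-val φ v∈K)) limit⊩φ))

  -- If no finite part of `Γ` entails `φ`, the construction can start from all valuations, and
  -- `limit` is a countermodel to `Γ ⊨ φ`.
  compactness : Γ ⊨ φ → ∃[ γs ] All (_∈ Γ) γs × γs ⊨ₗ φ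
  compactness Γ⊨φ with em {∃[ γs ] All (_∈ Γ) γs × γs ⊨ₗ φ}
  ... | yes found = found
  ... | no  none  = ⊥-elim (limit-⊮ open-U
                      (Γ⊨φ _ (eval-isHomomorphism 𝓕𝓞𝓤𝓡 (limit open-U)) (limit-⊩ open-U)))
    where
    open-U : Open U
    open-U (γs , γs⊆Γ , no-v) = none (γs , γs⊆Γ , λ v v⊩γs →
      decidable-stable (Tr? _) λ v⊮φ → no-v (v , _ , v⊩γs , v⊮φ))

-- The properties as introduction and elimination rules.

module _ {ℓ} {A : Set ℓ} (C : Pred A ℓ → Pred A ℓ) where

  Equiv : A → A → Set (lsuc ℓ)
  Equiv a b = ∀ {X} → a ∈ C X ⇔ b ∈ C X

  Conj : A → A → A → Set (lsuc ℓ)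
  Conj c a b = ∀ {X} → c ∈ C X ⇔ (a ∈ C X × b ∈ C X)

  -- In an abstract logic this amounts to `x ∈ C[ X ⨾ a ]`, by `entails⇒∈` and `∈⇒entails`.
  -- Quantifying over closed sets avoids the singleton, which involves the equality of the algebra.
  Entails : Pred A ℓ → A → A → Set (lsuc ℓ)
  Entails X a x = ∀ {Y} → X ⊆ C Y → a ∈ C Y → x ∈ C Y

  record Disj (c a b : A) : Set (lsuc ℓ) where
    field
      inject : ∀ {X} → a ∈ C X ⊎ b ∈ C X → c ∈ C X
      cases  : ∀ {X x} → c ∈ C X → Entails X a x → Entails X b x → x ∈ C X

open Disj

-- (PC), (PDI), (PDN) and (PDM) in terms of membership in closed sets only, so
-- that they do not depend on the equality of the algebra.
record Rules {ℓ} (𝕃 : AbstractLogic ℓ) : Set (lsuc ℓ) where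
  open AbstractLogic 𝕃
  field
    ∧-conj    : ∀ a b → Conj C (a ∧ b) a b
    ⊗-conj    : ∀ a b → Conj C (a ⊗ b) a b
    ¬∨-conj   : ∀ a b → Conj C (¬ (a ∨ b)) (¬ a) (¬ b)
    ¬⊗-conj   : ∀ a b → Conj C (¬ (a ⊗ b)) (¬ a) (¬ b)
    ∨-disj    : ∀ a b → Disj C (a ∨ b) a b
    ⊕-disj    : ∀ a b → Disj C (a ⊕ b) a b
    ¬∧-disj   : ∀ a b → Disj C (¬ (a ∧ b)) (¬ a) (¬ b)
    ¬⊕-disj   : ∀ a b → Disj C (¬ (a ⊕ b)) (¬ a) (¬ b)
    ¬¬-equiv  : ∀ a → Equiv C (¬ ¬ a) a

module AbstractLogicProperties {ℓ} (𝕃 : AbstractLogic ℓ) where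
  open AbstractLogic 𝕃
  module ≈ = IsEquivalence ≈-equivalence

  C-least : ∀ {X Y} → X ⊆ C Y → C X ⊆ C Y
  C-least {X} {Y} X⊆CY = idempotent Y ∘ monotone X (C Y) X⊆CY

  ⊆C-trans : ∀ {X Y Z : Pred Carrier ℓ} → X ⊆ C Y → Y ⊆ C Z → X ⊆ C Z
  ⊆C-trans X⊆CY Y⊆CZ = C-least Y⊆CZ ∘ X⊆CY

  singleton⊆ : ∀ {a Y} → a ∈ C Y → ｛ a ｝ ⊆ C Y
  singleton⊆ {Y = Y} a∈CY x≈a = respects Y (≈.sym x≈a) a∈CY

  ∪singleton⊆ : ∀ {X : Pred Carrier ℓ} {a Y} → X ⊆ C Y → a ∈ C Y → X ∪ ｛ a ｝ ⊆ C Y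
  ∪singleton⊆ X⊆CY a∈CY (inj₁ x∈X) = X⊆CY x∈X
  ∪singleton⊆ X⊆CY a∈CY (inj₂ x≈a) = singleton⊆ a∈CY x≈a

  list⊆ : ∀ {xs Y} → All (_∈ C Y) xs → ⟦ xs ⟧ ⊆ C Y
  list⊆ {Y = Y} = All.lookupₛ carrierSetoid (respects Y)

  ∈C[_] : ∀ a → a ∈ C[ a ]
  ∈C[ a ] = extensive _ ≈.refl

  ∈C[_⨾_] : ∀ X a → a ∈ C[ X ⨾ a ]
  ∈C[ X ⨾ a ] = extensive _ (inj₂ ≈.refl)

  ⊆C[_⨾_] : ∀ X a → X ⊆ C[ X ⨾ a ]
  ⊆C[ X ⨾ a ] = extensive _ ∘ inj₁

  entails⇒∈ : ∀ {X a x} → Entails C X a x → x ∈ C[ X ⨾ a ]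
  entails⇒∈ {X} {a} e = e ⊆C[ X ⨾ a ] ∈C[ X ⨾ a ]

  ∈⇒entails : ∀ {X a x} → x ∈ C[ X ⨾ a ] → Entails C X a x
  ∈⇒entails x∈ X⊆CY a∈CY = C-least (∪singleton⊆ X⊆CY a∈CY) x∈

  infix 4 _≋_
  _≋_ : Carrier → Carrier → Set ℓ
  a ≋ b = C[ a ] ≐ C[ b ]

  equiv⇒≋ : ∀ {a b} → Equiv C a b → a ≋ b
  equiv⇒≋ a⇔b = C-least (singleton⊆ (from a⇔b ∈C[ _ ])) , C-least (singleton⊆ (to a⇔b ∈C[ _ ]))

  ≋⇒equiv : ∀ {a b} → a ≋ b → Equiv C a b
  ≋⇒equiv (a⊆b , b⊆a) = mk⇔ (λ a∈ → C-least (singleton⊆ a∈) (b⊆a ∈C[ _ ]))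
                             (λ b∈ → C-least (singleton⊆ b∈) (a⊆b ∈C[ _ ]))

  -- `Conj` determines `c` up to `≋` from `a` and `b`. This and its counterpart `disj-≋` yield both
  -- (PDM) and the congruence laws of the quotient.
  conj-≋ : ∀ {c a b c′ a′ b′} → Conj C c a b → Conj C c′ a′ b′ → a ≋ a′ → b ≋ b′ → c ≋ c′
  conj-≋ conj conj′ a≋a′ b≋b′ = equiv⇒≋ $ mk⇔
    (λ c∈ → let a∈ , b∈ = to conj c∈ in from conj′ (to (≋⇒equiv a≋a′) a∈ , to (≋⇒equiv b≋b′) b∈))
    (λ c∈ → let a∈ , b∈ = to conj′ c∈ in from conj (from (≋⇒equiv a≋a′) a∈ , from (≋⇒equiv b≋b′) b∈))

  disj-≋ : ∀ {c a b c′ a′ b′} → Disj C c a b → Disj C c′ a′ b′ → a ≋ a′ → b ≋ b′ → c ≋ c′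
  disj-≋ disj disj′ a≋a′ b≋b′ = equiv⇒≋ $ mk⇔
    (λ c∈ → cases disj c∈ (λ _ → inject disj′ ∘ inj₁ ∘ to (≋⇒equiv a≋a′))
                          (λ _ → inject disj′ ∘ inj₂ ∘ to (≋⇒equiv b≋b′)))
    (λ c∈ → cases disj′ c∈ (λ _ → inject disj ∘ inj₁ ∘ from (≋⇒equiv a≋a′))
                           (λ _ → inject disj ∘ inj₂ ∘ from (≋⇒equiv b≋b′)))

  conj-resp : ∀ {c d a b} → c ≋ d → Conj C d a b → Conj C c a b
  conj-resp c≋d conj = mk⇔ (to conj ∘ to (≋⇒equiv c≋d)) (from (≋⇒equiv c≋d) ∘ from conj)

  disj-resp : ∀ {c d a b} → c ≋ d → Disj C d a b → Disj C c a b
  disj-resp c≋d disj = record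
    { inject = from (≋⇒equiv c≋d) ∘ inject disj
    ; cases  = cases disj ∘ to (≋⇒equiv c≋d)
    }

  conj⇒≐ : ∀ {c a b} → Conj C c a b → C[ c ] ≐ C (｛ a ｝ ∪ ｛ b ｝)
  conj⇒≐ conj =
    C-least (singleton⊆ (from conj (extensive _ (inj₁ ≈.refl) , extensive _ (inj₂ ≈.refl)))) ,
    (let a∈ , b∈ = to conj ∈C[ _ ] in C-least (∪singleton⊆ (singleton⊆ a∈) b∈))

  ≐⇒conj : ∀ {c a b} → C[ c ] ≐ C (｛ a ｝ ∪ ｛ b ｝) → Conj C c a b
  ≐⇒conj (c⊆ , ⊆c) = mk⇔
    (λ c∈ → let C[c]⊆ = C-least (singleton⊆ c∈) in
       C[c]⊆ (⊆c (extensive _ (inj₁ ≈.refl))) , C[c]⊆ (⊆c (extensive _ (inj₂ ≈.refl))))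
    (λ (a∈ , b∈) → C-least (∪singleton⊆ (singleton⊆ a∈) b∈) (c⊆ ∈C[ _ ]))

  disj⇒≐ : ∀ {c a b} → Disj C c a b → ∀ X → C[ X ⨾ c ] ≐ C[ X ⨾ a ] ∩ C[ X ⨾ b ]
  disj⇒≐ {c} disj X =
    (λ x∈ → ∈⇒entails x∈ ⊆C[ X ⨾ _ ] (inject disj (inj₁ ∈C[ X ⨾ _ ])) ,
            ∈⇒entails x∈ ⊆C[ X ⨾ _ ] (inject disj (inj₂ ∈C[ X ⨾ _ ]))) ,
    (λ (x∈a , x∈b) → cases disj ∈C[ X ⨾ c ]
       (λ X⊆ → ∈⇒entails x∈a (⊆C-trans ⊆C[ X ⨾ c ] X⊆))
       (λ X⊆ → ∈⇒entails x∈b (⊆C-trans ⊆C[ X ⨾ c ] X⊆)))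

  ≐⇒disj : ∀ {c a b} → (∀ X → C[ X ⨾ c ] ≐ C[ X ⨾ a ] ∩ C[ X ⨾ b ]) → Disj C c a b
  ≐⇒disj {c} eq = record
    { inject = λ {X} →
        let C[X⨾c]∋ = proj₁ (eq X) ∈C[ X ⨾ c ] in
        [ ∈⇒entails (proj₁ C[X⨾c]∋) (extensive X) , ∈⇒entails (proj₂ C[X⨾c]∋) (extensive X) ]′
    ; cases  = λ {X} c∈ a⊢x b⊢x →
        ∈⇒entails (proj₂ (eq X) (entails⇒∈ a⊢x , entails⇒∈ b⊢x)) (extensive X) c∈
    }

  Rules⇒properties : Rules 𝕃 → PC × PDI × PDN × PDM
  Rules⇒properties r = pc , pdi , pdn , pdm
    where
    open Rules r
    pc : PC
    pc a b = ≐-trans (conj⇒≐ (∧-conj a b)) (≐-sym (conj⇒≐ (⊗-conj a b))) , conj⇒≐ (⊗-conj a b)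
    pdi : PDI
    pdi X a b = ≐-trans (disj⇒≐ (∨-disj a b) X) (≐-sym (disj⇒≐ (⊕-disj a b) X)) ,
                disj⇒≐ (⊕-disj a b) X
    pdn : PDN
    pdn a = ≐-sym (equiv⇒≋ (¬¬-equiv a))
    pdm : PDM
    pdm a b = disj-≋ (¬∧-disj a b) (∨-disj (¬ a) (¬ b)) ≐-refl ≐-refl
            , conj-≋ (¬∨-conj a b) (∧-conj (¬ a) (¬ b)) ≐-refl ≐-refl
            , conj-≋ (¬⊗-conj a b) (⊗-conj (¬ a) (¬ b)) ≐-refl ≐-refl
            , disj-≋ (¬⊕-disj a b) (⊕-disj (¬ a) (¬ b)) ≐-refl ≐-refl

  properties⇒Rules : PC → PDI → PDN → PDM → Rules 𝕃
  properties⇒Rules pc pdi pdn pdm = record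
    { ∧-conj   = conj∧
    ; ⊗-conj   = conj⊗
    ; ¬∨-conj  = λ a b → conj-resp (proj₁ (proj₂ (pdm a b))) (conj∧ (¬ a) (¬ b))
    ; ¬⊗-conj  = λ a b → conj-resp (proj₁ (proj₂ (proj₂ (pdm a b)))) (conj⊗ (¬ a) (¬ b))
    ; ∨-disj   = disj∨
    ; ⊕-disj   = disj⊕
    ; ¬∧-disj  = λ a b → disj-resp (proj₁ (pdm a b)) (disj∨ (¬ a) (¬ b))
    ; ¬⊕-disj  = λ a b → disj-resp (proj₂ (proj₂ (proj₂ (pdm a b)))) (disj⊕ (¬ a) (¬ b))
    ; ¬¬-equiv = λ a → ≋⇒equiv (≐-sym (pdn a))
    }
    where
    conj⊗ : ∀ a b → Conj C (a ⊗ b) a b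
    conj⊗ a b = ≐⇒conj (proj₂ (pc a b))
    conj∧ : ∀ a b → Conj C (a ∧ b) a b
    conj∧ a b = conj-resp (proj₁ (pc a b)) (conj⊗ a b)
    disj⊕ : ∀ a b → Disj C (a ⊕ b) a b
    disj⊕ a b = ≐⇒disj λ X → proj₂ (pdi X a b)
    disj∨ : ∀ a b → Disj C (a ∨ b) a b
    disj∨ a b = ≐⇒disj λ X → ≐-trans (proj₁ (pdi X a b)) (proj₂ (pdi X a b))

-- Valuations read off from closed sets, and closed sets as filters.

valueOf : ∀ {p q} {P : Set p} {Q : Set q} → Dec P → Dec Q → Four
valueOf (yes _) (yes _) = ⊤₄
valueOf (yes _) (no _)  = 𝐭
valueOf (no _)  (yes _) = 𝐟
valueOf (no _)  (no _)  = ⊥₄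

Tr-valueOf : ∀ {p q} {P : Set p} {Q : Set q} (p? : Dec P) (q? : Dec Q) →
  valueOf p? q? ∈ Tr ⇔ P
Tr-valueOf (yes p) (yes _) = mk⇔ (λ _ → p) (λ _ → ⊤∈Tr)
Tr-valueOf (yes p) (no _)  = mk⇔ (λ _ → p) (λ _ → 𝐭∈Tr)
Tr-valueOf (no ¬p) (yes _) = mk⇔ (λ ()) (⊥-elim ∘ ¬p)
Tr-valueOf (no ¬p) (no _)  = mk⇔ (λ ()) (⊥-elim ∘ ¬p)

Tr-¬valueOf : ∀ {p q} {P : Set p} {Q : Set q} (p? : Dec P) (q? : Dec Q) →
  ¬₄ valueOf p? q? ∈ Tr ⇔ Q
Tr-¬valueOf (yes _) (yes q) = mk⇔ (λ _ → q) (λ _ → ⊤∈Tr)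
Tr-¬valueOf (no _)  (yes q) = mk⇔ (λ _ → q) (λ _ → 𝐭∈Tr)
Tr-¬valueOf (yes _) (no ¬q) = mk⇔ (λ ()) (⊥-elim ∘ ¬q)
Tr-¬valueOf (no _)  (no ¬q) = mk⇔ (λ ()) (⊥-elim ∘ ¬q)

module Soundness {ℓ} (em : ExcludedMiddle ℓ) (𝕃 : AbstractLogic ℓ) (rules : Rules 𝕃) where
  open AbstractLogic 𝕃
  open AbstractLogicProperties 𝕃
  open Rules rules

  -- Covering (Beth-style) semantics instead of prime closed sets, whose existence
  -- would need Zorn's lemma.
  record Describes (a : Carrier) (P : Pred (Pred Carrier ℓ) 0ℓ) : Set (lsuc ℓ) where
    field
      stable : ∀ {X Y} → X ⊆ C Y → P X → P Y
      forces : ∀ {X} → P X → a ∈ C X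
      covers : ∀ {X x} → a ∈ C X → (∀ {Y} → X ⊆ C Y → P Y → x ∈ C Y) → x ∈ C X
  open Describes

  describes-equiv : ∀ {a b P Q} → Equiv C a b → (∀ {X} → P X ⇔ Q X) →
    Describes b Q → Describes a P
  describes-equiv a⇔b P⇔Q d = record
    { stable = λ X⊆ → from P⇔Q ∘ stable d X⊆ ∘ to P⇔Q
    ; forces = from a⇔b ∘ forces d ∘ to P⇔Q
    ; covers = λ a∈ k → covers d (to a⇔b a∈) (λ X⊆ → k X⊆ ∘ from P⇔Q)
    }

  describes-conj : ∀ {a b c P Q R} → Conj C c a b → (∀ {X} → R X ⇔ (P X × Q X)) →
    Describes a P → Describes b Q → Describes c R
  describes-conj conj R⇔ da db = record
    { stable = λ X⊆ r → let p , q = to R⇔ r in from R⇔ (stable da X⊆ p , stable db X⊆ q)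
    ; forces = λ r → let p , q = to R⇔ r in from conj (forces da p , forces db q)
    ; covers = λ {X} c∈ k → let a∈ , b∈ = to conj c∈ in
        -- `stable` carries `P` from `Y` to the further extension on which `Q` is obtained.
        covers da a∈ λ {Y} X⊆CY p → covers db (C-least X⊆CY b∈) λ Y⊆CZ q →
        k (⊆C-trans X⊆CY Y⊆CZ) (from R⇔ (stable da Y⊆CZ p , q))
    }

  -- `C X` may contain a disjunction without containing either disjunct. `cases` passes to closed
  -- sets containing one of them, which is enough for `covers`.
  describes-disj : ∀ {a b c P Q R} → Disj C c a b → (∀ {X} → R X ⇔ (P X ⊎ Q X)) →
    Describes a P → Describes b Q → Describes c R
  describes-disj disj R⇔ da db = record
    { stable = λ X⊆ r → from R⇔ ([ inj₁ ∘ stable da X⊆ , inj₂ ∘ stable db X⊆ ]′ (to R⇔ r))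
    ; forces = λ r → inject disj ([ inj₁ ∘ forces da , inj₂ ∘ forces db ]′ (to R⇔ r))
    ; covers = λ c∈ k → cases disj c∈
        (λ X⊆CY a∈ → covers da a∈ λ Y⊆CZ → k (⊆C-trans X⊆CY Y⊆CZ) ∘ from R⇔ ∘ inj₁)
        (λ X⊆CY b∈ → covers db b∈ λ Y⊆CZ → k (⊆C-trans X⊆CY Y⊆CZ) ∘ from R⇔ ∘ inj₂)
    }

  describes-∈ : ∀ {a P} → (∀ {X} → P X ⇔ a ∈ C X) → Describes a P
  describes-∈ P⇔∈ = record
    { stable = λ X⊆ → from P⇔∈ ∘ C-least X⊆ ∘ to P⇔∈
    ; forces = to P⇔∈
    ; covers = λ a∈ k → k (extensive _) (from P⇔∈ a∈)
    }

  module _ {h : Formula → Carrier} (h-hom : IsHomomorphism 𝐅𝐦 algebra h) where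
    open IsHomomorphism h-hom

    -- Belnap's reading of the four values: a variable is told true if its image lies in `C X`, and
    -- told false if the negation of its image does.
    valuation : Pred Carrier ℓ → ℕ → Four
    valuation X n = valueOf (em {h (var n) ∈ C X}) (em {¬ h (var n) ∈ C X})

    True False : Formula → Pred (Pred Carrier ℓ) 0ℓ
    True  φ X = val (valuation X) φ ∈ Tr
    False φ X = ¬₄ val (valuation X) φ ∈ Tr

    ≈⇒equiv : ∀ {a b} → a ≈ b → Equiv C a b
    ≈⇒equiv a≈b = mk⇔ (respects _ a≈b) (respects _ (≈.sym a≈b))

    via : ∀ {a b P} → a ≈ b → Describes b P → Describes a P
    via a≈b = describes-equiv (≈⇒equiv a≈b) (mk⇔ id id)

    -- Simultaneous induction: the De Morgan rules reduce a negated compound to negated parts, and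
    -- double negation leads back to truth. At variables, `valuation X` records membership exactly.
    describes  : ∀ φ → Describes (h φ) (True φ)
    ¬describes : ∀ φ → Describes (¬ h φ) (False φ)

    describes (var n)  = describes-∈ (Tr-valueOf em em)
    describes (φ ∧ᶠ ψ) = via (∧-homo φ ψ) $
      describes-conj (∧-conj _ _) (Tr-∧ _ _) (describes φ) (describes ψ)
    describes (φ ∨ᶠ ψ) = via (∨-homo φ ψ) $
      describes-disj (∨-disj _ _) (Tr-∨ _ _) (describes φ) (describes ψ)
    describes (φ ⊗ᶠ ψ) = via (⊗-homo φ ψ) $
      describes-conj (⊗-conj _ _) (Tr-⊗ _ _) (describes φ) (describes ψ)
    describes (φ ⊕ᶠ ψ) = via (⊕-homo φ ψ) $
      describes-disj (⊕-disj _ _) (Tr-⊕ _ _) (describes φ) (describes ψ)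
    describes (¬ᶠ φ)   = via (¬-homo φ) (¬describes φ)

    ¬describes (var n)  = describes-∈ (Tr-¬valueOf em em)
    ¬describes (φ ∧ᶠ ψ) = via (¬-cong (∧-homo φ ψ)) $
      describes-disj (¬∧-disj _ _) (Tr-¬∧ _ _) (¬describes φ) (¬describes ψ)
    ¬describes (φ ∨ᶠ ψ) = via (¬-cong (∨-homo φ ψ)) $
      describes-conj (¬∨-conj _ _) (Tr-¬∨ _ _) (¬describes φ) (¬describes ψ)
    ¬describes (φ ⊗ᶠ ψ) = via (¬-cong (⊗-homo φ ψ)) $
      describes-conj (¬⊗-conj _ _) (Tr-¬⊗ _ _) (¬describes φ) (¬describes ψ)
    ¬describes (φ ⊕ᶠ ψ) = via (¬-cong (⊕-homo φ ψ)) $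
      describes-disj (¬⊕-disj _ _) (Tr-¬⊕ _ _) (¬describes φ) (¬describes ψ)
    ¬describes (¬ᶠ φ)   = via (¬-cong (¬-homo φ)) $
      describes-equiv (¬¬-equiv _) (Tr-¬¬ _) (describes φ)

    -- The premises are made true one after another, each on a larger closed set; `stable` keeps the
    -- earlier ones true.
    covers-all : ∀ γs {X x} → All (λ γ → h γ ∈ C X) γs →
      (∀ {Y} → X ⊆ C Y → valuation Y ⊩ γs → x ∈ C Y) → x ∈ C X
    covers-all []       []         k = k (extensive _) []
    covers-all (γ ∷ γs) (γ∈ ∷ γs∈) k =
      covers (describes γ) γ∈ λ X⊆CY ⊩γ →
      covers-all γs (All.map (C-least X⊆CY) γs∈) λ Y⊆CZ ⊩γs →
      k (⊆C-trans X⊆CY Y⊆CZ) (stable (describes γ) Y⊆CZ ⊩γ ∷ ⊩γs)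

    -- On a closed set whose valuation satisfies the premises, `φ` is true as well, and `forces`
    -- turns truth into membership.
    ⊨ₗ-sound : ∀ {γs φ X} → γs ⊨ₗ φ → All (λ γ → h γ ∈ C X) γs → h φ ∈ C X
    ⊨ₗ-sound {γs} {φ} γs⊨φ γs∈ = covers-all γs γs∈ λ _ → forces (describes φ) ∘ γs⊨φ _

  closed⇒filter : ∀ {F} → Closed F → IsFilter algebra F
  closed⇒filter {F} (CF⊆F , F⊆CF) = record
    { respects = λ a≈b → CF⊆F ∘ respects F a≈b ∘ F⊆CF
    ; closed   = λ Γ φ Γ⊨φ h h-hom hΓ⊆F →
        -- `covers-all` treats the premises one by one, so `Γ` is first cut down to a finite list.
        let γs , γs⊆Γ , γs⊨φ = compactness em Γ φ Γ⊨φ in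
        CF⊆F (⊨ₗ-sound h-hom γs⊨φ (All.map (λ γ∈Γ → F⊆CF (hΓ⊆F _ γ∈Γ)) γs⊆Γ))
    }

-- Filters of an arbitrary algebra.

module FilterProperties {ℓ} {𝐀 : Algebra ℓ ℓ} {F} (F-filter : IsFilter 𝐀 F) where
  open Algebra 𝐀
  open IsFilter F-filter
  private module ≈ = IsEquivalence ≈-equivalence

  -- `⊨` ranges over homomorphisms and `⊨ₗ` over valuations; every homomorphism into `𝓕𝓞𝓤𝓡` is the
  -- evaluation of its restriction to the variables.
  consequence : ∀ {γs φ} → γs ⊨ₗ φ → ∀ {h} → IsHomomorphism 𝐅𝐦 𝐀 h →
    All (λ γ → h γ ∈ F) γs → h φ ∈ F
  consequence {γs} {φ} γs⊨φ {h} h-hom γs∈ =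
    closed (λ γ → Lift ℓ (γ ∈ₗ γs)) φ semantic h h-hom (λ _ γ∈ → All.lookup γs∈ (lower γ∈))
    where
    semantic : (λ γ → Lift ℓ (γ ∈ₗ γs)) ⊨ φ
    semantic g g-hom g⊩ = subst Tr (val≡ φ)
      (γs⊨φ v (All.tabulate λ γ∈ → subst Tr (sym (val≡ _)) (g⊩ _ (lift γ∈))))
      where
      v : ℕ → Four
      v n = g (var n)
      val≡ : ∀ ψ → val v ψ ≡ g ψ
      val≡ = homomorphism-unique 𝓕𝓞𝓤𝓡 (eval-isHomomorphism 𝓕𝓞𝓤𝓡 v) g-hom (λ _ → refl)

  consequence₁ : ∀ {γ φ} → (∀ v → val v γ ∈ Tr → val v φ ∈ Tr) → ∀ ρ →
    eval 𝐀 ρ γ ∈ F → eval 𝐀 ρ φ ∈ F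
  consequence₁ {γ} {φ} γ⊨φ ρ γ∈ =
    consequence {[ γ ]} {φ} (λ v → γ⊨φ v ∘ All.head) (eval-isHomomorphism 𝐀 ρ) (γ∈ ∷ [])

  -- If Γ ⊨ φ, then { shift γ ∨ var 0 | γ ∈ Γ } ⊨ shift φ ∨ var 0, where var 0 is fresh.
  ∨-filter : ∀ b → IsFilter 𝐀 (λ a → a ∨ b ∈ F)
  ∨-filter b = record
    { respects = λ x≈y → respects (∨-cong x≈y ≈.refl)
    ; closed   = λ Γ φ Γ⊨φ h h-hom hΓ⊆ →
        let
          ρ : ℕ → Carrier
          ρ = λ where zero → b ; (suc n) → h (var n)
          g-hom = eval-isHomomorphism 𝐀 ρ
          g∘shift≈h : ∀ ψ → eval 𝐀 ρ (shift ψ) ≈ h ψ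
          g∘shift≈h = homomorphism-unique 𝐀 (shift-isHomomorphism g-hom) h-hom (λ _ → ≈.refl)
        in respects (∨-cong (g∘shift≈h φ) ≈.refl) $
           closed (λ δ → ∃[ γ ] γ ∈ Γ × δ ≡ shift γ ∨ᶠ var 0) (shift φ ∨ᶠ var 0)
             (shifted Γ φ Γ⊨φ) (eval 𝐀 ρ) g-hom
             λ { _ (γ , γ∈Γ , refl) →
                 respects (∨-cong (≈.sym (g∘shift≈h γ)) ≈.refl) (hΓ⊆ γ γ∈Γ) }
    }
    where
    shifted : ∀ Γ φ → Γ ⊨ φ →
      (λ δ → ∃[ γ ] γ ∈ Γ × δ ≡ shift γ ∨ᶠ var 0) ⊨ (shift φ ∨ᶠ var 0)
    -- If `var 0` is true, the conclusion holds through its right disjunct. Otherwise all premises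
    -- hold through their left disjuncts, so `g ∘ shift` satisfies `Γ`.
    shifted Γ φ Γ⊨φ g g-hom g⊩ with Tr? (g (var 0))
    ... | yes x₀∈Tr = subst Tr (sym (IsHomomorphism.∨-homo g-hom (shift φ) (var 0))) $
      from (Tr-∨ _ _) (inj₂ x₀∈Tr)
    ... | no  x₀∉Tr = subst Tr (sym (IsHomomorphism.∨-homo g-hom _ _)) $ from (Tr-∨ _ _) $ inj₁ $
      Γ⊨φ (g ∘ shift) (shift-isHomomorphism g-hom) λ γ γ∈Γ →
        [ id , ⊥-elim ∘ x₀∉Tr ]′
          (to (Tr-∨ _ _) (subst Tr (IsHomomorphism.∨-homo g-hom _ _) (g⊩ _ (γ , γ∈Γ , refl))))

-- The logic of all filters of an algebra.

assign : ∀ {a} {A : Set a} → A → A → ℕ → A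
assign a b zero    = a
assign a b (suc _) = b

x₀ x₁ : Formula
x₀ = var 0
x₁ = var 1

module FilterLogic {ℓ} (em : ExcludedMiddle ℓ) (𝕃 : AbstractLogic ℓ)
  (closed⇔filter : ClosedSetsAreExactlyFilters 𝕃) where
  open AbstractLogic 𝕃
  open AbstractLogicProperties 𝕃

  C-filter : ∀ X → IsFilter algebra (C X)
  C-filter X = to (closed⇔filter (C X)) (idempotent X , extensive (C X))

  -- Together with `C-filter` this makes `C X` the filter generated by `X`, so that facts about its
  -- elements follow by exhibiting a suitable filter.
  C⊆filter : ∀ {X F} → IsFilter algebra F → X ⊆ F → C X ⊆ F
  C⊆filter {X} {F} F-filter X⊆F =
    proj₁ (from (closed⇔filter F) F-filter) ∘ monotone X F X⊆F

  entails₁ : ∀ γ φ → (∀ v → val v γ ∈ Tr → val v φ ∈ Tr) → ∀ a b {X} →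
    eval algebra (assign a b) γ ∈ C X → eval algebra (assign a b) φ ∈ C X
  entails₁ γ φ γ⊨φ a b = FilterProperties.consequence₁ (C-filter _) {γ} {φ} γ⊨φ (assign a b)

  ∨-inject : ∀ a b {X} → a ∈ C X ⊎ b ∈ C X → a ∨ b ∈ C X
  ∨-inject a b =
    [ entails₁ x₀ (x₀ ∨ᶠ x₁) (λ _ → from (Tr-∨ _ _) ∘ inj₁) a b
    , entails₁ x₁ (x₀ ∨ᶠ x₁) (λ _ → from (Tr-∨ _ _) ∘ inj₂) a b ]′

  ∨-swap : ∀ a b {X} → a ∨ b ∈ C X → b ∨ a ∈ C X
  ∨-swap = entails₁ (x₀ ∨ᶠ x₁) (x₁ ∨ᶠ x₀)
    (λ v → from (Tr-∨ (v 1) (v 0)) ∘ [ inj₂ , inj₁ ]′ ∘ to (Tr-∨ _ _))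

  ∨-idem : ∀ a {X} → a ∨ a ∈ C X → a ∈ C X
  ∨-idem a = entails₁ (x₀ ∨ᶠ x₀) x₀ (λ _ → [ id , id ]′ ∘ to (Tr-∨ _ _)) a a

  -- `a⊢c` is applied to the filter `G`, which contains `X` because `x` entails `x ∨ b`, and
  -- contains `a` by assumption.
  ∨-entails : ∀ {X a b c} → Entails C X a c → a ∨ b ∈ C X → c ∨ b ∈ C X
  ∨-entails {X} {a} {b} {c} a⊢c a∨b∈ =
    C⊆filter G-filter id (a⊢c (λ x∈X → extensive G (∨-inject _ b (inj₁ (extensive X x∈X))))
                              (extensive G a∨b∈))
    where
    G : Pred Carrier ℓ
    G d = d ∨ b ∈ C X
    G-filter : IsFilter algebra G
    G-filter = FilterProperties.∨-filter (C-filter X) b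

  ∨-disj : ∀ a b → Disj C (a ∨ b) a b
  ∨-disj a b = record
    { inject = ∨-inject a b
    ; cases  = λ a∨b∈ a⊢x b⊢x →
        -- The chain is `a ∨ b`, `x ∨ b`, `b ∨ x`, `x ∨ x`, `x`.
        ∨-idem _ (∨-entails b⊢x (∨-swap _ b (∨-entails a⊢x a∨b∈)))
    }

  conj : ∀ γ α β → (∀ v → val v γ ∈ Tr ⇔ (val v α ∈ Tr × val v β ∈ Tr)) → ∀ a b →
    let e = eval algebra (assign a b) in Conj C (e γ) (e α) (e β)
  conj γ α β γ⇔ a b = mk⇔
    (λ γ∈ → entails₁ γ α (λ v → proj₁ ∘ to (γ⇔ v)) a b γ∈ ,
            entails₁ γ β (λ v → proj₂ ∘ to (γ⇔ v)) a b γ∈)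
    (λ (α∈ , β∈) → FilterProperties.consequence (C-filter _) {α ∷ β ∷ []} {γ}
       (λ where v (⊩α ∷ ⊩β ∷ []) → from (γ⇔ v) (⊩α , ⊩β))
       (eval-isHomomorphism algebra (assign a b)) (α∈ ∷ β∈ ∷ []))

  -- Semantically `γ` entails `α ∨ᶠ β`, so that its case analysis is inherited from `∨-disj`.
  disj : ∀ γ α β → (∀ v → val v γ ∈ Tr ⇔ (val v α ∈ Tr ⊎ val v β ∈ Tr)) → ∀ a b →
    let e = eval algebra (assign a b) in Disj C (e γ) (e α) (e β)
  disj γ α β γ⇔ a b = record
    { inject =
        [ entails₁ α γ (λ v → from (γ⇔ v) ∘ inj₁) a b
        , entails₁ β γ (λ v → from (γ⇔ v) ∘ inj₂) a b ]′
    ; cases = cases (∨-disj _ _) ∘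
        entails₁ γ (α ∨ᶠ β) (λ v → from (Tr-∨ _ _) ∘ to (γ⇔ v)) a b
    }

  rules : Rules 𝕃
  rules = record
    { ∧-conj   = conj (x₀ ∧ᶠ x₁) x₀ x₁ (λ _ → Tr-∧ _ _)
    ; ⊗-conj   = conj (x₀ ⊗ᶠ x₁) x₀ x₁ (λ _ → Tr-⊗ _ _)
    ; ¬∨-conj  = conj (¬ᶠ (x₀ ∨ᶠ x₁)) (¬ᶠ x₀) (¬ᶠ x₁) (λ v → Tr-¬∨ (v 0) (v 1))
    ; ¬⊗-conj  = conj (¬ᶠ (x₀ ⊗ᶠ x₁)) (¬ᶠ x₀) (¬ᶠ x₁) (λ v → Tr-¬⊗ (v 0) (v 1))
    ; ∨-disj   = ∨-disj
    ; ⊕-disj   = disj (x₀ ⊕ᶠ x₁) x₀ x₁ (λ _ → Tr-⊕ _ _)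
    ; ¬∧-disj  = disj (¬ᶠ (x₀ ∧ᶠ x₁)) (¬ᶠ x₀) (¬ᶠ x₁) (λ v → Tr-¬∧ (v 0) (v 1))
    ; ¬⊕-disj  = disj (¬ᶠ (x₀ ⊕ᶠ x₁)) (¬ᶠ x₀) (¬ᶠ x₁) (λ v → Tr-¬⊕ (v 0) (v 1))
    ; ¬¬-equiv = λ a → mk⇔
        (entails₁ (¬ᶠ ¬ᶠ x₀) x₀ (λ v → to (Tr-¬¬ (v 0))) a a)
        (entails₁ x₀ (¬ᶠ ¬ᶠ x₀) (λ v → from (Tr-¬¬ (v 0))) a a)
    }

  -- No formula is valid, since the constant valuation ⊥ makes every formula ⊥.
  empty : E
  empty = C⊆filter ∅-filter id , extensive ∅
    where
    val-⊥ : ∀ φ → val (λ _ → ⊥₄) φ ≡ ⊥₄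
    val-⊥ (var _)  = refl
    val-⊥ (φ ∧ᶠ ψ) = cong₂ _∧₄_ (val-⊥ φ) (val-⊥ ψ)
    val-⊥ (φ ∨ᶠ ψ) = cong₂ _∨₄_ (val-⊥ φ) (val-⊥ ψ)
    val-⊥ (φ ⊗ᶠ ψ) = cong₂ _⊗₄_ (val-⊥ φ) (val-⊥ ψ)
    val-⊥ (φ ⊕ᶠ ψ) = cong₂ _⊕₄_ (val-⊥ φ) (val-⊥ ψ)
    val-⊥ (¬ᶠ φ)   = cong ¬₄_ (val-⊥ φ)
    ⊥∉Tr : Not (⊥₄ ∈ Tr)
    ⊥∉Tr ()
    ∅-filter : IsFilter algebra ∅
    ∅-filter = record
      { respects = λ _ ()
      ; closed   = λ Γ φ Γ⊨φ h _ hΓ⊆∅ → ⊥-elim $ ⊥∉Tr $ subst Tr (val-⊥ φ) $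
          Γ⊨φ _ (eval-isHomomorphism 𝓕𝓞𝓤𝓡 _) (λ γ γ∈Γ → ⊥-elim (lower (hΓ⊆∅ γ γ∈Γ)))
      }

  -- The elements generated by finite parts of `X` form a filter containing `X`: by compactness a
  -- conclusion uses finitely many premises, and `join` pools their generators.
  finitary : Finitary
  finitary X a = C⊆filter F-filter λ {b} b∈X → [ b ] , b∈X ∷ [] , extensive _ (here ≈.refl)
    where
    F : Pred Carrier ℓ
    F b = ∃[ xs ] All (_∈ X) xs × b ∈ C ⟦ xs ⟧

    join : ∀ (h : Formula → Carrier) {γs} → All (λ γ → h γ ∈ F) γs →
      ∃[ xs ] All (_∈ X) xs × All (λ γ → h γ ∈ C ⟦ xs ⟧) γs
    join h []       = [] , [] , []
    join h ((xs , xs⊆X , γ∈) ∷ γs∈F) =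
      let ys , ys⊆X , γs∈ = join h γs∈F in
      xs ++ ys , ++⁺ xs⊆X ys⊆X ,
      monotone _ _ (∈-++⁺ˡ carrierSetoid) γ∈ ∷ All.map (monotone _ _ (∈-++⁺ʳ carrierSetoid xs)) γs∈

    F-filter : IsFilter algebra F
    F-filter = record
      { respects = λ b≈c (xs , xs⊆X , b∈) → xs , xs⊆X , respects _ b≈c b∈
      ; closed   = λ Γ φ Γ⊨φ h h-hom hΓ⊆F →
          let γs , γs⊆Γ , γs⊨φ = compactness em Γ φ Γ⊨φ
              xs , xs⊆X , γs∈  = join h (All.map (hΓ⊆F _) γs⊆Γ)
          in xs , xs⊆X , FilterProperties.consequence (C-filter _) γs⊨φ h-hom γs∈
      }

-- Pulling the properties back along a bilogical morphism.

module BilogicalMorphism {ℓ} {𝕃 𝕃′ : AbstractLogic ℓ} {h}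
  (h-bilogical : IsBilogicalMorphism 𝕃 𝕃′ h) where
  private
    module L  = AbstractLogic 𝕃
    module P  = AbstractLogicProperties 𝕃
    module L′ = AbstractLogic 𝕃′
    module P′ = AbstractLogicProperties 𝕃′
    module ≈′ = P′.≈
  open IsBilogicalMorphism h-bilogical
  open IsHomomorphism isHomomorphism

  -- The slack between `h a` and `b` absorbs the homomorphism equations, so that a rule of `𝕃′` at
  -- `h a ∧ h b` applies directly to `a ∧ b`.
  ∈C : ∀ {X a b} → h a L′.≈ b → a ∈ L.C X ⇔ b ∈ L′.C (image X)
  ∈C {X} {a} ha≈b = mk⇔
    (L′.respects _ ha≈b ∘ to (bilogical X a))
    (from (bilogical X a) ∘ L′.respects _ (≈′.sym ha≈b))

  image⊆ : ∀ {X Y′} → (∀ {a} → a ∈ X → h a ∈ L′.C Y′) → image X ⊆ L′.C Y′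
  image⊆ {Y′ = Y′} hX⊆ (_ , x∈X , hx≈) = L′.respects Y′ hx≈ (hX⊆ x∈X)

  equiv-pullback : ∀ {a b a′ b′} → h a L′.≈ a′ → h b L′.≈ b′ →
    Equiv L′.C a′ b′ → Equiv L.C a b
  equiv-pullback a≈ b≈ equiv = mk⇔
    (from (∈C b≈) ∘ to equiv ∘ to (∈C a≈)) (from (∈C a≈) ∘ from equiv ∘ to (∈C b≈))

  conj-pullback : ∀ {c a b c′ a′ b′} → h c L′.≈ c′ → h a L′.≈ a′ → h b L′.≈ b′ →
    Conj L′.C c′ a′ b′ → Conj L.C c a b
  conj-pullback c≈ a≈ b≈ conj = mk⇔
    (λ c∈ → let a∈ , b∈ = to conj (to (∈C c≈) c∈) in from (∈C a≈) a∈ , from (∈C b≈) b∈)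
    (λ (a∈ , b∈) → from (∈C c≈) (from conj (to (∈C a≈) a∈ , to (∈C b≈) b∈)))

  -- The passage through `z ∈ C[ X ⨾ a ]` leaves only the images of the generators to be checked
  -- against the arbitrary closed set of `𝕃′`.
  entails-image : ∀ {X a a′ z} → h a L′.≈ a′ →
    Entails L.C X a z → Entails L′.C (image X) a′ (h z)
  entails-image {X} {a} {a′} a≈ a⊢z {Y′} hX⊆ a′∈ =
    P′.C-least (image⊆ generators) (to (∈C ≈′.refl) (P.entails⇒∈ a⊢z))
    where
    generators : ∀ {b} → b ∈ X ∪ L.｛ a ｝ → h b ∈ L′.C Y′
    generators (inj₁ b∈X) = hX⊆ (_ , b∈X , ≈′.refl)
    generators (inj₂ b≈a) = L′.respects Y′ (≈′.sym (≈′.trans (≈-cong b≈a) a≈)) a′∈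

  disj-pullback : ∀ {c a b c′ a′ b′} → h c L′.≈ c′ → h a L′.≈ a′ → h b L′.≈ b′ →
    Disj L′.C c′ a′ b′ → Disj L.C c a b
  disj-pullback c≈ a≈ b≈ disj = record
    { inject = [ from (∈C c≈) ∘ inject disj ∘ inj₁ ∘ to (∈C a≈)
               , from (∈C c≈) ∘ inject disj ∘ inj₂ ∘ to (∈C b≈) ]′
    ; cases  = λ c∈ a⊢z b⊢z → from (∈C ≈′.refl)
        (cases disj (to (∈C c≈) c∈) (entails-image a≈ a⊢z) (entails-image b≈ b⊢z))
    }

  rules-pullback : Rules 𝕃′ → Rules 𝕃
  rules-pullback r = record
    { ∧-conj   = λ a b → conj-pullback (∧-homo a b) ≈′.refl ≈′.refl (∧-conj _ _)
    ; ⊗-conj   = λ a b → conj-pullback (⊗-homo a b) ≈′.refl ≈′.refl (⊗-conj _ _)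
    ; ¬∨-conj  = λ a b → conj-pullback (¬-homo₂ (∨-homo a b)) (¬-homo a) (¬-homo b) (¬∨-conj _ _)
    ; ¬⊗-conj  = λ a b → conj-pullback (¬-homo₂ (⊗-homo a b)) (¬-homo a) (¬-homo b) (¬⊗-conj _ _)
    ; ∨-disj   = λ a b → disj-pullback (∨-homo a b) ≈′.refl ≈′.refl (∨-disj _ _)
    ; ⊕-disj   = λ a b → disj-pullback (⊕-homo a b) ≈′.refl ≈′.refl (⊕-disj _ _)
    ; ¬∧-disj  = λ a b → disj-pullback (¬-homo₂ (∧-homo a b)) (¬-homo a) (¬-homo b) (¬∧-disj _ _)
    ; ¬⊕-disj  = λ a b → disj-pullback (¬-homo₂ (⊕-homo a b)) (¬-homo a) (¬-homo b) (¬⊕-disj _ _)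
    ; ¬¬-equiv = λ a → equiv-pullback (¬-homo₂ (¬-homo a)) ≈′.refl (¬¬-equiv _)
    }
    where
    open Rules r
    ¬-homo₂ : ∀ {a a′} → h a L′.≈ a′ → h (L.¬ a) L′.≈ L′.¬ a′
    ¬-homo₂ ha≈ = ≈′.trans (¬-homo _) (L′.¬-cong ha≈)

  empty-pullback : L′.E → L.E
  empty-pullback (C∅⊆∅ , _) = no-theorem , L.extensive L.∅
    where
    image-∅ : image L.∅ ⊆ L′.C L′.∅
    image-∅ (_ , () , _)
    no-theorem : L.C L.∅ ⊆ L.∅
    no-theorem a∈ with () ← C∅⊆∅ (P′.C-least image-∅ (to (∈C ≈′.refl) a∈))

  preimages : ∀ {X ys} → All (_∈ image X) ys →
    ∃[ xs ] All (_∈ X) xs × All (λ y → y ∈ L′.C (image L.⟦ xs ⟧)) ys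
  preimages []                          = [] , [] , []
  preimages ((x , x∈X , hx≈y) ∷ ys∈) =
    let xs , xs⊆X , ys⊆ = preimages ys∈ in
    x ∷ xs , x∈X ∷ xs⊆X ,
    L′.extensive _ (x , here P.≈.refl , hx≈y) ∷
    All.map (L′.monotone _ _ λ (z , z∈ , hz≈) → z , there z∈ , hz≈) ys⊆

  finitary-pullback : L′.Finitary → L.Finitary
  finitary-pullback finitary′ X a a∈ =
    let ys , ys⊆ , ha∈ = finitary′ (image X) (h a) (to (∈C ≈′.refl) a∈)
        xs , xs⊆ , ys∈ = preimages ys⊆
    in xs , xs⊆ , from (∈C ≈′.refl) (P′.C-least (P′.list⊆ ys∈) ha∈)

-- The quotient whose closed sets are exactly the filters.

module Reduction {ℓ} (em : ExcludedMiddle ℓ) (𝕃 : AbstractLogic ℓ)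
  (rules : Rules 𝕃) (finitary : AbstractLogic.Finitary 𝕃) (empty : AbstractLogic.E 𝕃) where
  open AbstractLogic 𝕃
  open AbstractLogicProperties 𝕃
  open Rules rules

  infix 4 _∼_
  -- The Tarski congruence of the logic, that is, the largest congruence contained in `≋`. Comparing
  -- negations as well makes it compatible with `¬_`.
  _∼_ : Carrier → Carrier → Set ℓ
  a ∼ b = a ≋ b × ¬ a ≋ ¬ b

  ≈⇒≋ : ∀ {a b} → a ≈ b → a ≋ b
  ≈⇒≋ a≈b = equiv⇒≋ (mk⇔ (respects _ a≈b) (respects _ (≈.sym a≈b)))

  ≈⇒∼ : ∀ {a b} → a ≈ b → a ∼ b
  ≈⇒∼ a≈b = ≈⇒≋ a≈b , ≈⇒≋ (¬-cong a≈b)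

  quotient : Algebra ℓ ℓ
  quotient = record
    { _≈_ = _∼_
    ; ≈-equivalence = record
      { refl  = ≐-refl , ≐-refl
      ; sym   = λ (p , q) → ≐-sym p , ≐-sym q
      ; trans = λ (p , q) (p′ , q′) → ≐-trans p p′ , ≐-trans q q′
      }
    ; _∧_ = _∧_ ; _∨_ = _∨_ ; _⊗_ = _⊗_ ; _⊕_ = _⊕_ ; ¬_ = ¬_
    -- The second components concern negated compounds: negation exchanges conjunctive and
    -- disjunctive behaviour for `∧` and `∨`, and preserves it for `⊗` and `⊕`.
    ; ∧-cong = λ (p , p′) (q , q′) →
        conj-≋ (∧-conj _ _) (∧-conj _ _) p q , disj-≋ (¬∧-disj _ _) (¬∧-disj _ _) p′ q′
    ; ∨-cong = λ (p , p′) (q , q′) →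
        disj-≋ (∨-disj _ _) (∨-disj _ _) p q , conj-≋ (¬∨-conj _ _) (¬∨-conj _ _) p′ q′
    ; ⊗-cong = λ (p , p′) (q , q′) →
        conj-≋ (⊗-conj _ _) (⊗-conj _ _) p q , conj-≋ (¬⊗-conj _ _) (¬⊗-conj _ _) p′ q′
    ; ⊕-cong = λ (p , p′) (q , q′) →
        disj-≋ (⊕-disj _ _) (⊕-disj _ _) p q , disj-≋ (¬⊕-disj _ _) (¬⊕-disj _ _) p′ q′
    ; ¬-cong = λ (p , p′) → p′ ,
        ≐-trans (equiv⇒≋ (¬¬-equiv _)) (≐-trans p (≐-sym (equiv⇒≋ (¬¬-equiv _))))
    }

  reduced : AbstractLogic ℓ
  reduced = record
    { algebra    = quotient
    ; C          = C
    ; respects   = λ _ (a≋b , _) → to (≋⇒equiv a≋b)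
    ; extensive  = extensive
    ; monotone   = monotone
    ; idempotent = idempotent
    }

  reduced-rules : Rules reduced
  reduced-rules = record { Rules rules }

  module _ {F} (F-filter : IsFilter quotient F) where
    open FilterProperties F-filter
    open IsFilter F-filter renaming (respects to F-respects) using ()

    upward-closed : ∀ {a b} → a ∈ C[ b ] → b ∈ F → a ∈ F
    upward-closed {a} {b} a∈C[b] b∈F = F-respects t∼a t∈F
      where
      t : Carrier
      -- Since `b` entails `a`, all disjuncts of `t` entail `a`. Its negation behaves as `¬ a` and
      -- (`¬ a` or `¬ b`), which is absorbed into `¬ a`; the negation of `a ∨ b` would demand `¬ b`
      -- too.
      t = a ∨ (a ⊕ b)
      t∈F : t ∈ F
      t∈F = consequence₁ {x₁} {x₀ ∨ᶠ (x₀ ⊕ᶠ x₁)}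
        (λ v → from (Tr-∨ (v 0) _) ∘ inj₂ ∘ from (Tr-⊕ (v 0) (v 1)) ∘ inj₂) (assign a b) b∈F
      b⊢a : ∀ {X} → b ∈ C X → a ∈ C X
      b⊢a b∈ = C-least (singleton⊆ b∈) a∈C[b]
      t∼a : t ∼ a
      t∼a = equiv⇒≋ (mk⇔
              (λ t∈ → cases (∨-disj _ _) t∈ (λ _ → id) λ _ a⊕b∈ →
                 cases (⊕-disj _ _) a⊕b∈ (λ _ → id) (λ _ → b⊢a))
              (inject (∨-disj _ _) ∘ inj₁))
          , equiv⇒≋ (mk⇔
              (proj₁ ∘ to (¬∨-conj _ _))
              (λ ¬a∈ → from (¬∨-conj _ _) (¬a∈ , inject (¬⊕-disj _ _) (inj₁ ¬a∈))))

    -- Restricted to nonempty lists, as the language has no constant to serve as an empty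
    -- conjunction.
    conjunction : ∀ {a as} → All (_∈ F) (a ∷ as) → ∃[ b ] b ∈ F × All (_∈ C[ b ]) (a ∷ as)
    conjunction {a} (a∈F ∷ [])           = a , a∈F , ∈C[ a ] ∷ []
    conjunction {a} (a∈F ∷ as∈F@(_ ∷ _)) =
      let b , b∈F , as∈ = conjunction as∈F
          a∈ , b∈ = to (∧-conj a b) ∈C[ a ∧ b ]
          a∧b∈F = consequence {x₀ ∷ x₁ ∷ []} {x₀ ∧ᶠ x₁}
            (λ where _ (⊩x ∷ ⊩y ∷ []) → from (Tr-∧ _ _) (⊩x , ⊩y))
            (eval-isHomomorphism quotient (assign a b)) (a∈F ∷ b∈F ∷ [])
      in a ∧ b , a∧b∈F , a∈ ∷ All.map (C-least (singleton⊆ b∈)) as∈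

    filter⊇C : C F ⊆ F
    filter⊇C {a} a∈CF with finitary F a a∈CF
    -- An empty list of generators would put `a` into `C ∅`, against (E).
    ... | []     , _    , a∈ with () ← proj₁ empty (C-least (list⊆ []) a∈)
    ... | _ ∷ _ , xs∈F , a∈ =
      let b , b∈F , xs∈ = conjunction xs∈F in upward-closed (C-least (list⊆ xs∈) a∈) b∈F

  reduced-closed⇔filter : ClosedSetsAreExactlyFilters reduced
  reduced-closed⇔filter F = mk⇔
    (Soundness.closed⇒filter em reduced reduced-rules)
    (λ F-filter → filter⊇C F-filter , extensive F)

  id-bilogical : IsBilogicalMorphism 𝕃 reduced id
  id-bilogical = record
    { isHomomorphism = record
      { ≈-cong = ≈⇒∼
      ; ∧-homo = λ _ _ → ∼-refl ; ∨-homo = λ _ _ → ∼-refl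
      ; ⊗-homo = λ _ _ → ∼-refl ; ⊕-homo = λ _ _ → ∼-refl
      ; ¬-homo = λ _ → ∼-refl
      }
    ; surjective = λ a → a , ≈⇒∼
    ; bilogical  = λ X a → mk⇔
        (monotone _ _ λ z∈X → _ , z∈X , ∼-refl)
        -- The image of `X` under `id` is its saturation under `∼`, which stays within `C X` because
        -- `∼` implies `≋`.
        (C-least λ (z , z∈X , z≋ , _) → to (≋⇒equiv z≋) (extensive X z∈X))
    }
    where
    ∼-refl : ∀ {a} → a ∼ a
    ∼-refl = ≐-refl , ≐-refl

  isFullModel : IsFullModel 𝕃
  isFullModel = reduced , reduced-closed⇔filter , id , id-bilogical

theorem3p4p11 : ∀ {ℓ : Level} → ExcludedMiddle ℓ → (𝕃 : AbstractLogic ℓ) →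
    let open AbstractLogic 𝕃 in
    IsFullModel 𝕃 ⇔ (Finitary × E × PC × PDI × PDN × PDM)
theorem3p4p11 em 𝕃 = mk⇔
  (λ (𝕃′ , closed⇔filter , _ , h-bilogical) →
     let module L′ = FilterLogic em 𝕃′ closed⇔filter
         open BilogicalMorphism h-bilogical
     in finitary-pullback L′.finitary , empty-pullback L′.empty ,
        Rules⇒properties (rules-pullback L′.rules))
  (λ (finitary , empty , pc , pdi , pdn , pdm) →
     Reduction.isFullModel em 𝕃 (properties⇒Rules pc pdi pdn pdm) finitary empty)
  where open AbstractLogicProperties 𝕃
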